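{- There exist a $\lambda$-term $M$ and a real number $0<\varepsilon<1$ such that $$\mathsf{ExpLen}_M(\varepsilon)<\mathsf{ExpLen}_M(1)=\mathsf{Steps}_{\mathsf{LO}}(M)<\mathsf{ExpLen}_M(0)=\mathsf{Steps}_{\mathsf{RI}}(M),$$ where the values lie in $\mathbb{R}\cup\{+\infty\}$.
   Context: $\lambda$-terms: $\Lambda$ is the set of untyped $\lambda$-terms $M,N ::= x \mid MN \mid \lambda x.M$ ($x$ in a countably infinite set of variables), modulo $\alpha$-equivalence. A $\beta$-redex is a term $(\lambda x.M)N$; its contractum is $M\{N/x\}$ (capture-avoiding substitution). $M\to_\beta N$ means that $N$ is obtained from $M$ by replacing one occurrence of a redex in $M$ (anywhere in the term) by its contractum. A term is in normal form if it has no $\beta$-reduct, reducible otherwise. The leftmost-outermost ($\mathsf{LO}$) redex of a reducible term is the leftmost among its redexes, and the rightmost-innermost ($\mathsf{RI}$) redex is the rightmost among its redexes, the position of a redex being measured by its beginning symbol in the written term. $\mathsf{LO}(M)$, $\mathsf{RI}(M)$ denote the terms obtained from $M$ by firing these redexes. For $\mathsf{S}\in\{\mathsf{LO},\mathsf{RI}\}$, $\mathsf{Steps}_{\mathsf{S}}(M)$ is the length of the sequence $M,\mathsf{S}(M),\mathsf{S}(\mathsf{S}(M)),\dots$ (number of steps) if it reaches a normal form, and $+\infty$ otherwise. For $\varepsilon\in[0,1]$, the randomised strategy $\mathsf{P}_\varepsilon$ assigns to each reducible term $M$ the distribution $\mathsf{P}_\varepsilon(M)=\varepsilon\,\delta_{\mathsf{LO}(M)}+(1-\varepsilon)\,\delta_{\mathsf{RI}(M)}$;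 it is undefined on normal forms. Put $\mathbb{P}(M\to N)=\mathsf{P}_\varepsilon(M)(N)$ if $M$ is reducible, $0$ if $M$ is a normal form. The computation starting from $M$ is the sequence $(\rho_i)_{i\in\mathbb{N}}$ with $\rho_0$ the Dirac distribution at $M$ and $\rho_{i+1}(N)=\sum_{L}\rho_i(L)\,\mathbb{P}(L\to N)$. Write $|\rho|=\sum_N\rho(N)$ and $\mathsf{ExpLen}_M(\varepsilon)=\mathsf{Steps}_{\mathsf{P}_\varepsilon}(M)=\sum_{i=1}^\infty|\rho_i|\in\mathbb{R}\cup\{+\infty\}$. -}

module Defs where

import Algebra.Bundles
open import Data.Bool.Base using (if_then_else_)
open import Data.List.Base as List using (List; []; _∷_; _++_; concatMap; foldr)
open import Data.List.Membership.Propositional using (_∈_)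
open import Data.List.Membership.Propositional.Properties using (∈-map⁺; ∈-++⁺ˡ; ∈-++⁺ʳ)
open import Data.List.Relation.Unary.All as All using (All; []; _∷_)
import Data.List.Relation.Unary.All.Properties as All
open import Data.List.Relation.Unary.AllPairs as AllPairs using (AllPairs; []; _∷_)
import Data.List.Relation.Unary.AllPairs.Properties as AllPairsₚ
open import Data.List.Relation.Unary.Any using (here; there)
open import Data.Maybe.Base as Maybe using (Maybe; just; nothing; _>>=_; fromMaybe; zipWith)
open import Data.Nat.Base as ℕ using (ℕ; zero; suc)
import Data.Nat.Properties as ℕ
open import Data.Product.Base using (∃-syntax; _×_; _,_)
open import Data.Rational.Base as ℚ using (ℚ; 0ℚ; 1ℚ; ½; ∣_∣)
import Data.Rational.Properties as ℚ
open import Algebra.Properties.CommutativeSemigroup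
  (Algebra.Bundles.CommutativeMonoid.commutativeSemigroup ℚ.+-0-commutativeMonoid)
  using (interchange)
open import Data.Integer.Base using (+_)
open import Relation.Binary.Definitions using (DecidableEquality)
open import Relation.Binary.PropositionalEquality
open import Relation.Nullary.Decidable using (yes; no; does; map′; _×-dec_)
open import Relation.Nullary.Negation using (¬_)
open import Relation.Nullary.Construct.Add.Supremum using (_⁺; [_]; ⊤⁺)

------------------------------------------------------------------------
-- Real numbers: Cauchy sequences of rationals, compared up to _≈ℝ_.

IsCauchy : (ℕ → ℚ) → Set
IsCauchy x = ∀ δ → 0ℚ ℚ.< δ →
  ∃[ N ] ∀ m n → N ℕ.≤ m → N ℕ.≤ n → ∣ x m ℚ.- x n ∣ ℚ.< δ

record ℝ : Set where
  constructor mkℝ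
  field
    seq    : ℕ → ℚ
    cauchy : IsCauchy seq

open ℝ public

private abstract
  ½* : ℚ → ℚ
  ½* δ = ½ ℚ.* δ

  ½*-pos : ∀ δ → 0ℚ ℚ.< δ → 0ℚ ℚ.< ½* δ
  ½*-pos δ 0<δ = subst (ℚ._< ½* δ) (ℚ.*-zeroʳ ½) (ℚ.*-monoʳ-<-pos ½ 0<δ)

  ½+½ : ∀ δ → ½* δ ℚ.+ ½* δ ≡ δ
  ½+½ δ = trans (sym (ℚ.*-distribʳ-+ δ ½ ½)) (ℚ.*-identityˡ δ)

  const-cauchy : ∀ q → IsCauchy (λ _ → q)
  const-cauchy q δ 0<δ = 0 , λ _ _ _ _ →
    subst (ℚ._< δ) (sym (cong ∣_∣ (ℚ.+-inverseʳ q))) 0<δ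

  +-cauchy : ∀ x y → IsCauchy x → IsCauchy y → IsCauchy (λ n → x n ℚ.+ y n)
  +-cauchy x y cx cy δ 0<δ with cx (½* δ) (½*-pos δ 0<δ) | cy (½* δ) (½*-pos δ 0<δ)
  ... | N₁ , h₁ | N₂ , h₂ = N₁ ℕ.⊔ N₂ , λ m n p q → begin-strict
      ∣ (x m ℚ.+ y m) ℚ.- (x n ℚ.+ y n) ∣
    ≡⟨ cong ∣_∣ (rearrange (x m) (y m) (x n) (y n)) ⟩
      ∣ (x m ℚ.- x n) ℚ.+ (y m ℚ.- y n) ∣
    ≤⟨ ℚ.∣p+q∣≤∣p∣+∣q∣ (x m ℚ.- x n) (y m ℚ.- y n) ⟩
      ∣ x m ℚ.- x n ∣ ℚ.+ ∣ y m ℚ.- y n ∣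
    <⟨ ℚ.+-mono-< (h₁ m n (ℕ.m⊔n≤o⇒m≤o N₁ N₂ p) (ℕ.m⊔n≤o⇒m≤o N₁ N₂ q))
                  (h₂ m n (ℕ.m⊔n≤o⇒n≤o N₁ N₂ p) (ℕ.m⊔n≤o⇒n≤o N₁ N₂ q)) ⟩
      ½* δ ℚ.+ ½* δ
    ≡⟨ ½+½ δ ⟩
      δ ∎
    where
    open ℚ.≤-Reasoning
    rearrange : ∀ a b c d → (a ℚ.+ b) ℚ.- (c ℚ.+ d) ≡ (a ℚ.- c) ℚ.+ (b ℚ.- d)
    rearrange a b c d = trans (cong ((a ℚ.+ b) ℚ.+_) (ℚ.neg-distrib-+ c d))
                              (interchange a b (ℚ.- c) (ℚ.- d))

  neg-cauchy : ∀ x → IsCauchy x → IsCauchy (λ n → ℚ.- x n)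
  neg-cauchy x cx δ 0<δ with cx δ 0<δ
  ... | N , h = N , λ m n p q → subst (ℚ._< δ)
    (trans (sym (ℚ.∣-p∣≡∣p∣ (x m ℚ.- x n))) (cong ∣_∣ (ℚ.neg-distrib-+ (x m) (ℚ.- x n)))) (h m n p q)

  eventually-bounded : ∀ x → IsCauchy x →
    ∃[ B ] 0ℚ ℚ.< B × ∃[ N ] ∀ n → N ℕ.≤ n → ∣ x n ∣ ℚ.≤ B
  eventually-bounded x cx with cx 1ℚ (ℚ.positive⁻¹ 1ℚ)
  ... | N , h = 1ℚ ℚ.+ ∣ x N ∣
              , ℚ.<-≤-trans (ℚ.positive⁻¹ 1ℚ)
                  (subst (ℚ._≤ 1ℚ ℚ.+ ∣ x N ∣) (ℚ.+-identityʳ 1ℚ)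
                    (ℚ.+-monoʳ-≤ 1ℚ (ℚ.0≤∣p∣ (x N))))
              , N , λ n p → begin
      ∣ x n ∣                       ≡⟨ cong ∣_∣ (rearrange (x n) (x N)) ⟩
      ∣ (x n ℚ.- x N) ℚ.+ x N ∣     ≤⟨ ℚ.∣p+q∣≤∣p∣+∣q∣ (x n ℚ.- x N) (x N) ⟩
      ∣ x n ℚ.- x N ∣ ℚ.+ ∣ x N ∣   ≤⟨ ℚ.+-monoˡ-≤ ∣ x N ∣ (ℚ.<⇒≤ (h n N p ℕ.≤-refl)) ⟩
      1ℚ ℚ.+ ∣ x N ∣                ∎
    where
    open ℚ.≤-Reasoning
    rearrange : ∀ a b → a ≡ (a ℚ.- b) ℚ.+ b
    rearrange a b = sym (trans (ℚ.+-assoc a (ℚ.- b) b)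
                          (trans (cong (a ℚ.+_) (ℚ.+-inverseˡ b)) (ℚ.+-identityʳ a)))

  fraction : ∀ B δ → 0ℚ ℚ.< B → 0ℚ ℚ.< δ → ∃[ η ] 0ℚ ℚ.< η × B ℚ.* η ≡ δ
  fraction B δ 0<B 0<δ = (ℚ.1/ B) ℚ.* δ
    , ℚ.positive⁻¹ _ {{ℚ.pos*pos⇒pos (ℚ.1/ B) {{ℚ.1/pos⇒pos B}} δ}}
    , trans (sym (ℚ.*-assoc B (ℚ.1/ B) δ))
        (trans (cong (ℚ._* δ) (ℚ.*-inverseʳ B)) (ℚ.*-identityˡ δ))
    where instance
      posB : ℚ.Positive B
      posB = ℚ.positive 0<B
      posδ : ℚ.Positive δ
      posδ = ℚ.positive 0<δ
      nzB : ℚ.NonZero B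
      nzB = ℚ.pos⇒nonZero B

  *-bound : ∀ a {B b η} → 0ℚ ℚ.< B → ∣ a ∣ ℚ.≤ B → ∣ b ∣ ℚ.< η → ∣ a ℚ.* b ∣ ℚ.< B ℚ.* η
  *-bound a {B} {b} {η} 0<B a≤B b<η = begin-strict
      ∣ a ℚ.* b ∣       ≡⟨ ℚ.∣p*q∣≡∣p∣*∣q∣ a b ⟩
      ∣ a ∣ ℚ.* ∣ b ∣   ≤⟨ ℚ.*-monoʳ-≤-nonNeg ∣ b ∣ {{ℚ.∣-∣-nonNeg b}} a≤B ⟩
      B ℚ.* ∣ b ∣       <⟨ ℚ.*-monoʳ-<-pos B {{ℚ.positive 0<B}} b<η ⟩
      B ℚ.* η           ∎
    where open ℚ.≤-Reasoning

  *-cauchy : ∀ x y → IsCauchy x → IsCauchy y → IsCauchy (λ n → x n ℚ.* y n)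
  *-cauchy x y cx cy δ 0<δ with eventually-bounded x cx | eventually-bounded y cy
  ... | B , 0<B , K , boundx | C , 0<C , L , boundy
    with fraction B (½* δ) 0<B (½*-pos δ 0<δ) | fraction C (½* δ) 0<C (½*-pos δ 0<δ)
  ... | η , 0<η , Bη | θ , 0<θ , Cθ with cy η 0<η | cx θ 0<θ
  ... | N₁ , h₁ | N₂ , h₂ = K ℕ.⊔ L ℕ.⊔ (N₁ ℕ.⊔ N₂) , λ m n p q →
    let p₁ = ℕ.m⊔n≤o⇒m≤o (K ℕ.⊔ L) (N₁ ℕ.⊔ N₂) p
        q₁ = ℕ.m⊔n≤o⇒m≤o (K ℕ.⊔ L) (N₁ ℕ.⊔ N₂) q
        p₂ = ℕ.m⊔n≤o⇒n≤o (K ℕ.⊔ L) (N₁ ℕ.⊔ N₂) p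
        q₂ = ℕ.m⊔n≤o⇒n≤o (K ℕ.⊔ L) (N₁ ℕ.⊔ N₂) q
    in begin-strict
      ∣ x m ℚ.* y m ℚ.- x n ℚ.* y n ∣
    ≡⟨ cong ∣_∣ (rearrange (x m) (y m) (x n) (y n)) ⟩
      ∣ x m ℚ.* (y m ℚ.- y n) ℚ.+ y n ℚ.* (x m ℚ.- x n) ∣
    ≤⟨ ℚ.∣p+q∣≤∣p∣+∣q∣ (x m ℚ.* (y m ℚ.- y n)) (y n ℚ.* (x m ℚ.- x n)) ⟩
      ∣ x m ℚ.* (y m ℚ.- y n) ∣ ℚ.+ ∣ y n ℚ.* (x m ℚ.- x n) ∣
    <⟨ ℚ.+-mono-<
         (*-bound (x m) {b = y m ℚ.- y n} 0<B (boundx m (ℕ.m⊔n≤o⇒m≤o K L p₁))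
           (h₁ m n (ℕ.m⊔n≤o⇒m≤o N₁ N₂ p₂) (ℕ.m⊔n≤o⇒m≤o N₁ N₂ q₂)))
         (*-bound (y n) {b = x m ℚ.- x n} 0<C (boundy n (ℕ.m⊔n≤o⇒n≤o K L q₁))
           (h₂ m n (ℕ.m⊔n≤o⇒n≤o N₁ N₂ p₂) (ℕ.m⊔n≤o⇒n≤o N₁ N₂ q₂))) ⟩
      B ℚ.* η ℚ.+ C ℚ.* θ
    ≡⟨ cong₂ ℚ._+_ Bη Cθ ⟩
      ½* δ ℚ.+ ½* δ
    ≡⟨ ½+½ δ ⟩
      δ ∎
    where
    open ℚ.≤-Reasoning
    distrib : ∀ a b c → a ℚ.* (b ℚ.- c) ≡ a ℚ.* b ℚ.- a ℚ.* c
    distrib a b c = trans (ℚ.*-distribˡ-+ a b (ℚ.- c))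
      (cong (a ℚ.* b ℚ.+_) (sym (ℚ.neg-distribʳ-* a c)))
    telescope : ∀ p q r → (p ℚ.- q) ℚ.+ (q ℚ.- r) ≡ p ℚ.- r
    telescope p q r = trans (ℚ.+-assoc p (ℚ.- q) (q ℚ.- r)) (cong (p ℚ.+_)
      (trans (sym (ℚ.+-assoc (ℚ.- q) q (ℚ.- r)))
        (trans (cong (ℚ._- r) (ℚ.+-inverseˡ q)) (ℚ.+-identityˡ (ℚ.- r)))))
    rearrange : ∀ a b c d → a ℚ.* b ℚ.- c ℚ.* d ≡ a ℚ.* (b ℚ.- d) ℚ.+ d ℚ.* (a ℚ.- c)
    rearrange a b c d = sym (trans
      (cong₂ ℚ._+_ (distrib a b d)
        (trans (distrib d a c) (cong₂ ℚ._-_ (ℚ.*-comm d a) (ℚ.*-comm d c))))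
      (telescope (a ℚ.* b) (a ℚ.* d) (c ℚ.* d)))

fromℚ : ℚ → ℝ
fromℚ q = mkℝ (λ _ → q) (const-cauchy q)

fromℕ : ℕ → ℝ
fromℕ n = fromℚ (+ n ℚ./ 1)

0ℝ 1ℝ : ℝ
0ℝ = fromℚ 0ℚ
1ℝ = fromℚ 1ℚ

infixl 6 _+ℝ_ _-ℝ_
infixl 7 _*ℝ_
infix  4 _≈ℝ_ _<ℝ_

_+ℝ_ _*ℝ_ _-ℝ_ : ℝ → ℝ → ℝ
x +ℝ y = mkℝ (λ n → seq x n ℚ.+ seq y n)
  (+-cauchy (seq x) (seq y) (cauchy x) (cauchy y))
x *ℝ y = mkℝ (λ n → seq x n ℚ.* seq y n)
  (*-cauchy (seq x) (seq y) (cauchy x) (cauchy y))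
x -ℝ y = mkℝ (λ n → seq x n ℚ.- seq y n)
  (+-cauchy (seq x) (λ n → ℚ.- seq y n) (cauchy x) (neg-cauchy (seq y) (cauchy y)))

_≈ℝ_ : ℝ → ℝ → Set
x ≈ℝ y = ∀ δ → 0ℚ ℚ.< δ → ∃[ N ] ∀ n → N ℕ.≤ n → ∣ seq x n ℚ.- seq y n ∣ ℚ.< δ

_<ℝ_ : ℝ → ℝ → Set
x <ℝ y = ∃[ δ ] 0ℚ ℚ.< δ × ∃[ N ] ∀ n → N ℕ.≤ n → seq x n ℚ.+ δ ℚ.≤ seq y n

-- ℝ ⁺ is ℝ ∪ {+∞}, with ⊤⁺ as +∞.

open import Relation.Binary.Construct.Add.Supremum.Equality _≈ℝ_ public using (_≈⁺_)
open import Relation.Binary.Construct.Add.Supremum.Strict _<ℝ_ public using (_<⁺_)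

fromℕ⁺ : ℕ ⁺ → ℝ ⁺
fromℕ⁺ = Maybe.map fromℕ

Tendsto : (ℕ → ℝ) → ℝ ⁺ → Set
Tendsto s [ x ] = ∀ δ → 0ℚ ℚ.< δ → ∃[ N ] ∀ n → N ℕ.≤ n →
                    (x -ℝ fromℚ δ <ℝ s n) × (s n <ℝ x +ℝ fromℚ δ)
Tendsto s ⊤⁺    = ∀ K → ∃[ N ] ∀ n → N ℕ.≤ n → fromℚ K <ℝ s n

-- Σ₁ f n = f 1 + … + f n
Σ₁ : (ℕ → ℝ) → ℕ → ℝ
Σ₁ f zero    = 0ℝ
Σ₁ f (suc n) = Σ₁ f n +ℝ f (suc n)

------------------------------------------------------------------------
-- λ-terms modulo α, as de Bruijn terms.  An index pointing beyond all
-- enclosing binders is a free variable.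

infixl 7 _·_
infixr 6 ƛ_

data Λ : Set where
  var : ℕ → Λ
  _·_ : Λ → Λ → Λ
  ƛ_  : Λ → Λ

_≟_ : DecidableEquality Λ
var x   ≟ var y   = map′ (cong var) (λ { refl → refl }) (x ℕ.≟ y)
var _   ≟ (_ · _) = no λ ()
var _   ≟ (ƛ _)   = no λ ()
(_ · _) ≟ var _   = no λ ()
(M · N) ≟ (P · Q) = map′ (λ { (refl , refl) → refl }) (λ { refl → refl , refl })
                         (M ≟ P ×-dec N ≟ Q)
(_ · _) ≟ (ƛ _)   = no λ ()
(ƛ _)   ≟ var _   = no λ ()
(ƛ _)   ≟ (_ · _) = no λ ()
(ƛ M)   ≟ (ƛ N)   = map′ (cong ƛ_) (λ { refl → refl }) (M ≟ N)

extendʳ : (ℕ → ℕ) → ℕ → ℕ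
extendʳ f zero    = zero
extendʳ f (suc x) = suc (f x)

rename : (ℕ → ℕ) → Λ → Λ
rename f (var x) = var (f x)
rename f (M · N) = rename f M · rename f N
rename f (ƛ M)   = ƛ rename (extendʳ f) M

extendˢ : (ℕ → Λ) → ℕ → Λ
extendˢ σ zero    = var zero
extendˢ σ (suc x) = rename suc (σ x)

substitute : (ℕ → Λ) → Λ → Λ
substitute σ (var x) = σ x
substitute σ (M · N) = substitute σ M · substitute σ N
substitute σ (ƛ M)   = ƛ substitute (extendˢ σ) M

-- The contractum of (ƛ M) · N is M [ N ]₀; the free variables of M are
-- lowered since its binder disappears.
_[_]₀ : Λ → Λ → Λ
M [ N ]₀ = substitute (λ { zero → N ; (suc x) → var x }) M

-- Occurrences of β-redexes in a term.
data Redex : Λ → Set where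
  root : ∀ {M N} → Redex ((ƛ M) · N)
  inˡ  : ∀ {M N} → Redex M → Redex (M · N)
  inʳ  : ∀ {M N} → Redex N → Redex (M · N)
  inƛ  : ∀ {M}   → Redex M → Redex (ƛ M)

fire : ∀ {M} → Redex M → Λ
fire (root {M} {N})  = M [ N ]₀
fire (inˡ {N = N} r) = fire r · N
fire (inʳ {M = M} r) = M · fire r
fire (inƛ r)         = ƛ fire r

infix 4 _→β_

_→β_ : Λ → Λ → Set
M →β N = ∃[ r ] fire {M} r ≡ N

NormalForm : Λ → Set
NormalForm M = ∀ N → ¬ (M →β N)

-- The redexes of a term from left to right.  A term is written as x,
-- (MN) or (λx.M), so a redex begins at its opening parenthesis, before
-- every redex of its function part, which in turn begins before every
-- redex of its argument.
redexes : ∀ M → List (Redex M)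
redexes (var x)         = []
redexes (ƛ M)           = List.map inƛ (redexes M)
redexes (M@(ƛ _) · N)   = root ∷ List.map inˡ (redexes M) ++ List.map inʳ (redexes N)
redexes (M · N)         = List.map inˡ (redexes M) ++ List.map inʳ (redexes N)

Strategy : Set
Strategy = Λ → Maybe Λ

LO RI : Strategy
LO M = Maybe.map fire (List.head (redexes M))
RI M = Maybe.map fire (List.last (redexes M))

iterate : Strategy → ℕ → Λ → Maybe Λ
iterate S zero    M = just M
iterate S (suc n) M = iterate S n M >>= S

-- IsSteps S M v: Steps_S(M) = v in ℕ ∪ {+∞}.
IsSteps : Strategy → Λ → ℕ ⁺ → Set
IsSteps S M [ n ] = ∃[ N ] iterate S n M ≡ just N × NormalForm N
IsSteps S M ⊤⁺    = ∀ n → ∃[ N ] iterate S n M ≡ just N × ¬ NormalForm N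

-- Number of symbols in x, (MN) and (λx.M).
size : Λ → ℕ
size (var x) = 1
size (M · N) = 2 ℕ.+ (size M ℕ.+ size N)
size (ƛ M)   = 5 ℕ.+ size M

-- Position of the first symbol of a redex in the written term.
start : ∀ {M} → Redex M → ℕ
start root            = 0
start (inˡ r)         = 1 ℕ.+ start r
start (inʳ {M = M} r) = 1 ℕ.+ (size M ℕ.+ start r)
start (inƛ r)         = 4 ℕ.+ start r

private
  start<size : ∀ {M} (r : Redex M) → start r ℕ.< size M
  start<size root = ℕ.s≤s ℕ.z≤n
  start<size (inˡ {M} {N} r) = ℕ.s≤s (ℕ.≤-trans (start<size r)
    (ℕ.≤-trans (ℕ.m≤m+n (size M) (size N)) (ℕ.n≤1+n _)))
  start<size (inʳ {M} r) = ℕ.s≤s (ℕ.m≤n⇒m≤1+n (ℕ.+-monoʳ-< (size M) (start<size r)))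
  start<size (inƛ r) = ℕ.m≤n⇒m≤1+n (ℕ.+-monoʳ-< 4 (start<size r))

Sorted : ∀ {M} → List (Redex M) → Set
Sorted = AllPairs (λ r s → start r ℕ.< start s)

redexes-sorted   : ∀ M → Sorted (redexes M)
redexes-complete : ∀ {M} (r : Redex M) → r ∈ redexes M

private
  app-sorted : ∀ {M N rs ss} → Sorted {M} rs → Sorted {N} ss →
               Sorted {M · N} (List.map inˡ rs ++ List.map inʳ ss)
  app-sorted {M} {N} {rs} {ss} srs sss = AllPairsₚ.++⁺
    (AllPairsₚ.map⁺ (AllPairs.map ℕ.s≤s srs))
    (AllPairsₚ.map⁺ (AllPairs.map
      (λ p → ℕ.s≤s (ℕ.+-monoʳ-< (size M) p)) sss))
    (All.map⁺ (All.universal (λ r → All.map⁺ (All.universal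
      (λ s → ℕ.s≤s (ℕ.≤-trans (start<size r) (ℕ.m≤m+n (size M) (start s)))) ss)) rs))

redexes-sorted (var x)           = []
redexes-sorted (ƛ M)             = AllPairsₚ.map⁺
  (AllPairs.map (ℕ.+-monoʳ-< 4) (redexes-sorted M))
redexes-sorted (M@(ƛ _) · N)     =
  All.++⁺ (All.map⁺ (All.universal (λ _ → ℕ.z<s) (redexes M)))
          (All.map⁺ (All.universal (λ _ → ℕ.z<s) (redexes N)))
  ∷ app-sorted (redexes-sorted M) (redexes-sorted N)
redexes-sorted (M@(var _) · N)   = app-sorted (redexes-sorted M) (redexes-sorted N)
redexes-sorted (M@(_ · _) · N)   = app-sorted (redexes-sorted M) (redexes-sorted N)

redexes-complete root              = here refl
redexes-complete (inˡ {_ · _} r)   = ∈-++⁺ˡ (∈-map⁺ inˡ (redexes-complete r))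
redexes-complete (inˡ {ƛ _} r)     = there (∈-++⁺ˡ (∈-map⁺ inˡ (redexes-complete r)))
redexes-complete (inʳ {var _} r)   = ∈-map⁺ inʳ (redexes-complete r)
redexes-complete (inʳ {M@(_ · _)} r) =
  ∈-++⁺ʳ (List.map inˡ (redexes M)) (∈-map⁺ inʳ (redexes-complete r))
redexes-complete (inʳ {M@(ƛ _)} r) =
  there (∈-++⁺ʳ (List.map inˡ (redexes M)) (∈-map⁺ inʳ (redexes-complete r)))
redexes-complete (inƛ r)           = ∈-map⁺ inƛ (redexes-complete r)

------------------------------------------------------------------------
-- Randomised reduction.  Every ρᵢ has finite support, so distributions
-- are formal sums: the list (w₁ , M₁) ∷ … ∷ (wₖ , Mₖ) ∷ [] stands for
-- w₁ δ_{M₁} + … + wₖ δ_{Mₖ}.  A term may be listed several times, its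
-- weights adding up.

Dist : Set
Dist = List (ℝ × Λ)

δ[_] : Λ → Dist
δ[ M ] = (1ℝ , M) ∷ []

infixr 7 _⊙_

_⊙_ : ℝ → Dist → Dist
w ⊙ ρ = List.map (λ (v , M) → w *ℝ v , M) ρ

∥_∥ : Dist → ℝ
∥ ρ ∥ = foldr (λ (w , _) s → w +ℝ s) 0ℝ ρ

-- The empty sum on normal forms, where neither LO nor RI is defined.
P : ℝ → Λ → Dist
P ε M = fromMaybe [] (zipWith (λ L R → ε ⊙ δ[ L ] ++ (1ℝ -ℝ ε) ⊙ δ[ R ]) (LO M) (RI M))

step : ℝ → Dist → Dist
step ε = concatMap (λ (w , M) → w ⊙ P ε M)

computation : ℝ → Λ → ℕ → Dist
computation ε M zero    = δ[ M ]
computation ε M (suc i) = step ε (computation ε M i)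

-- IsExpLen M ε v: ExpLen_M(ε) = v in ℝ ∪ {+∞}.  The value of the series
-- is given by a relation because convergence is not decidable.
IsExpLen : Λ → ℝ → ℝ ⁺ → Set
IsExpLen M ε v = Tendsto (Σ₁ (λ i → ∥ computation ε M i ∥)) v

_⟨_⟩ : Dist → Λ → ℝ
ρ ⟨ N ⟩ = foldr (λ (w , M) s → if does (M ≟ N) then w +ℝ s else s) 0ℝ ρ

private
  ++-coeff : ∀ ρ σ N n → seq ((ρ ++ σ) ⟨ N ⟩) n ≡ seq (ρ ⟨ N ⟩) n ℚ.+ seq (σ ⟨ N ⟩) n
  ++-coeff []            σ N n = sym (ℚ.+-identityˡ (seq (σ ⟨ N ⟩) n))
  ++-coeff ((w , M) ∷ ρ) σ N n with M ≟ N
  ... | no  _ = ++-coeff ρ σ N n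
  ... | yes _ = trans (cong (seq w n ℚ.+_) (++-coeff ρ σ N n))
      (sym (ℚ.+-assoc (seq w n) (seq (ρ ⟨ N ⟩) n) (seq (σ ⟨ N ⟩) n)))

  ⊙-coeff : ∀ w ρ N n → seq ((w ⊙ ρ) ⟨ N ⟩) n ≡ seq w n ℚ.* seq (ρ ⟨ N ⟩) n
  ⊙-coeff w []            N n = sym (ℚ.*-zeroʳ (seq w n))
  ⊙-coeff w ((v , M) ∷ ρ) N n with M ≟ N
  ... | no  _ = ⊙-coeff w ρ N n
  ... | yes _ = trans (cong ((seq w n ℚ.* seq v n) ℚ.+_) (⊙-coeff w ρ N n))
                      (sym (ℚ.*-distribˡ-+ (seq w n) (seq v n) (seq (ρ ⟨ N ⟩) n)))

-- (step ρ)(N) = Σ_L ρ(L) ℙ(L → N)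
step-coeff : ∀ ε ρ N n →
  seq (step ε ρ ⟨ N ⟩) n ≡ seq (foldr (λ (w , L) s → w *ℝ (P ε L ⟨ N ⟩) +ℝ s) 0ℝ ρ) n
step-coeff ε []            N n = refl
step-coeff ε ((w , L) ∷ ρ) N n =
  trans (++-coeff (w ⊙ P ε L) (step ε ρ) N n)
        (cong₂ ℚ._+_ (⊙-coeff w (P ε L) N n) (step-coeff ε ρ N n))

{-# OPTIONS --safe #-}
-- Let M = (λw. (λx. f x x x) (I I)) (I (I (I y))).  LO discards the useless
-- argument at once but copies the redex I I three times: 1 + 4 steps.  RI
-- contracts I I only once but first normalises the useless argument: 3 + 3
-- steps.  Tossing a fair coin wastes less than one step on average in the
-- useless argument, and half of the time contracts I I before it is copied.
-- All reductions of M are finite, so each series has finitely many nonzero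
-- terms and its value can be computed.
module Submission where

open import Defs
open import Data.Integer.Base using (+_)
open import Data.List.Base using ([])
open import Data.List.Membership.Propositional using (_∈_)
open import Data.Nat.Base as ℕ using (ℕ; _≤′_; ≤′-refl; ≤′-step)
import Data.Nat.Properties as ℕ
open import Data.Product.Base using (Σ-syntax; _×_; _,_)
open import Data.Rational.Base as ℚ using (ℚ; 0ℚ; 1ℚ; ½; ∣_∣)
import Data.Rational.Properties as ℚ
open import Relation.Binary.Construct.Add.Supremum.Equality _≈ℝ_ using () renaming ([_] to ≈[_])
open import Relation.Binary.Construct.Add.Supremum.Strict _<ℝ_ using () renaming ([_] to <[_])
open import Relation.Binary.PropositionalEquality
open import Relation.Nullary.Construct.Add.Supremum using (_⁺; [_])

<ℝ-gap : ∀ x y q → 0ℚ ℚ.< q → (∀ n → seq x n ℚ.+ q ≡ seq y n) → x <ℝ y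
<ℝ-gap x y q 0<q x+q≡y = q , 0<q , 0 , λ n _ → ℚ.≤-reflexive (x+q≡y n)

≈ℝ-refl : ∀ x → x ≈ℝ x
≈ℝ-refl x δ 0<δ = 0 , λ n _ → subst (ℚ._< δ) (sym (cong ∣_∣ (ℚ.+-inverseʳ (seq x n)))) 0<δ

-- The sequences agree termwise, so `δ` itself is the gap in both strict inequalities.
eventually-const⇒Tendsto : ∀ s x k →
  (∀ n → k ℕ.≤ n → ∀ i → seq (s n) i ≡ seq x i) → Tendsto s [ x ]
eventually-const⇒Tendsto s x k s≡x δ 0<δ = k , λ n k≤n →
  <ℝ-gap (x -ℝ fromℚ δ) (s n) δ 0<δ (λ i → begin
    (seq x i ℚ.- δ) ℚ.+ δ     ≡⟨ ℚ.+-assoc (seq x i) (ℚ.- δ) δ ⟩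
    seq x i ℚ.+ (ℚ.- δ ℚ.+ δ) ≡⟨ cong (seq x i ℚ.+_) (ℚ.+-inverseˡ δ) ⟩
    seq x i ℚ.+ 0ℚ            ≡⟨ ℚ.+-identityʳ (seq x i) ⟩
    seq x i                   ≡⟨ s≡x n k≤n i ⟨
    seq (s n) i               ∎) ,
  <ℝ-gap (s n) (x +ℝ fromℚ δ) δ 0<δ (λ i → cong (ℚ._+ δ) (s≡x n k≤n i))
  where open ≡-Reasoning

-- `step` maps the empty sum to itself.
computation-[] : ∀ ε M {k n} → computation ε M k ≡ [] → k ≤′ n → computation ε M n ≡ []
computation-[] ε M ρₖ≡[] ≤′-refl       = ρₖ≡[]
computation-[] ε M ρₖ≡[] (≤′-step k≤n) = cong (step ε) (computation-[] ε M ρₖ≡[] k≤n)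

partialLen : Λ → ℝ → ℕ → ℝ
partialLen M ε = Σ₁ (λ i → ∥ computation ε M i ∥)

partialLen-const : ∀ M ε {k n} → computation ε M k ≡ [] → k ≤′ n →
  ∀ i → seq (partialLen M ε n) i ≡ seq (partialLen M ε k) i
partialLen-const M ε ρₖ≡[] ≤′-refl i = refl
partialLen-const M ε ρₖ≡[] (≤′-step {n} k≤n) i = trans
  (cong (λ ρ → seq (partialLen M ε n) i ℚ.+ seq ∥ ρ ∥ i)
    (computation-[] ε M ρₖ≡[] (≤′-step k≤n)))
  (trans (ℚ.+-identityʳ (seq (partialLen M ε n) i)) (partialLen-const M ε ρₖ≡[] k≤n i))

computation-[]⇒IsExpLen : ∀ M ε x k → computation ε M k ≡ [] →
  (∀ i → seq (partialLen M ε k) i ≡ seq x i) → IsExpLen M ε [ x ]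
computation-[]⇒IsExpLen M ε x k ρₖ≡[] len≡x = eventually-const⇒Tendsto (partialLen M ε) x k
  λ n k≤n i → trans (partialLen-const M ε ρₖ≡[] (ℕ.≤⇒≤′ k≤n) i) (len≡x i)

redexes-[]⇒NormalForm : ∀ {M} → redexes M ≡ [] → NormalForm M
redexes-[]⇒NormalForm M≡[] _ (r , _) with subst (r ∈_) M≡[] (redexes-complete r)
... | ()

I : Λ
I = ƛ var 0

-- Under λw and λx, the free variable f is var 2; at the top level, y is var 1.
term : Λ
term = (ƛ (ƛ var 2 · var 0 · var 0 · var 0) · (I · I)) · (I · (I · (I · var 1)))

mainTheorem3 : Σ[ M ∈ Λ ] Σ[ ε ∈ ℝ ] (0ℝ <ℝ ε) × (ε <ℝ 1ℝ) ×
    (Σ[ a ∈ ℝ ⁺ ] Σ[ b ∈ ℝ ⁺ ] Σ[ c ∈ ℝ ⁺ ] Σ[ m ∈ ℕ ⁺ ] Σ[ n ∈ ℕ ⁺ ]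
    IsExpLen M ε a × IsExpLen M 1ℝ b × IsExpLen M 0ℝ c ×
    IsSteps LO M m × IsSteps RI M n ×
    (a <⁺ b) × (b ≈⁺ fromℕ⁺ m) × (b <⁺ c) × (c ≈⁺ fromℕ⁺ n))
mainTheorem3 =
  term , fromℚ ½ ,
  <ℝ-gap 0ℝ (fromℚ ½) ½ 0<½ (λ _ → refl) ,
  <ℝ-gap (fromℚ ½) 1ℝ ½ 0<½ (λ _ → refl) ,
  [ fromℚ len½ ] , [ fromℕ 5 ] , [ fromℕ 6 ] , [ 5 ] , [ 6 ] ,
  -- The longest run has 8 steps: 3 of RI in the argument, then 5 of LO. Branches of weight 0 stay
  -- listed, so `9` is also the bound for `1ℝ` and `0ℝ`.
  computation-[]⇒IsExpLen term (fromℚ ½) (fromℚ len½) 9 refl (λ _ → refl) ,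
  computation-[]⇒IsExpLen term 1ℝ (fromℕ 5) 9 refl (λ _ → refl) ,
  computation-[]⇒IsExpLen term 0ℝ (fromℕ 6) 9 refl (λ _ → refl) ,
  (_ , refl , redexes-[]⇒NormalForm refl) ,
  (_ , refl , redexes-[]⇒NormalForm refl) ,
  <[ <ℝ-gap (fromℚ len½) (fromℕ 5) (+ 3 ℚ./ 16) (ℚ.positive⁻¹ _) (λ _ → refl) ] ,
  ≈[ ≈ℝ-refl (fromℕ 5) ] ,
  <[ <ℝ-gap (fromℕ 5) (fromℕ 6) 1ℚ (ℚ.positive⁻¹ 1ℚ) (λ _ → refl) ] ,
  ≈[ ≈ℝ-refl (fromℕ 6) ]
  where
  len½ : ℚ
  -- Once the argument is discarded with `I · I` intact, (4 + 2)/2 = 3 steps are expected. With k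
  -- redexes left in the argument and `I · I` intact, E₀ = 7/2 and Eₖ = 1 + 3/2 + Eₖ₋₁/2; this is
  -- E₃.
  len½ = + 77 ℚ./ 16

  0<½ : 0ℚ ℚ.< ½
  0<½ = ℚ.positive⁻¹ ½
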